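{- For integers $s,t\ge 4$, $$r_{pot}(K_s,K_{1,t-1})=\begin{cases}2s, & \text{if } t<s+2,\\ t+s-2, & \text{otherwise.}\end{cases}$$
   Context: All graphs are finite and simple. A sequence of nonnegative integers $\pi=(d_1,\dots,d_n)$ (always taken nonincreasing) is graphic if some graph of order $n$ has degree sequence $\pi$; such a graph is a realization of $\pi$. For a graph $H$, a graphic sequence $\pi$ is potentially $H$-graphic if some realization of $\pi$ contains $H$ as a subgraph. For an $N$-term sequence $\pi=(d_1,\dots,d_N)$, the complementary sequence is $\overline{\pi}=(N-1-d_N,\dots,N-1-d_1)$. For graphs $H_1,H_2$, the potential-Ramsey number $r_{pot}(H_1,H_2)$ is the minimum integer $N$ such that for every $N$-term graphic sequence $\pi$, either $\pi$ is potentially $H_1$-graphic or $\overline{\pi}$ is potentially $H_2$-graphic. $K_s$ is the complete graph on $s$ vertices and $K_{1,t-1}$ is the star with $t-1$ leaves. -}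

module Defs where

open import Data.Nat using (ℕ; zero; suc; _+_; _*_; _∸_; _≤_; _<_; _<ᵇ_)
open import Data.Fin using (Fin; opposite) renaming (_≤_ to _≤ᶠ_; zero to fzero)
import Data.Fin as Fin
import Data.Empty
open import Data.Fin.Properties using (_≟_)
open import Data.Bool using (Bool; true; false; not; if_then_else_)
open import Data.List using (List; map; allFin)
open import Data.Nat.ListAction using (sum)
open import Data.Product using (Σ; ∃; _×_; _,_)
open import Data.Sum using (_⊎_)
open import Relation.Nullary using (¬_)
open import Relation.Nullary.Decidable using (⌊_⌋; dec-true)
open import Relation.Binary.PropositionalEquality using (_≡_; refl; cong; sym)
open import Function.Definitions using (Injective)

record Graph (n : ℕ) : Set where
  field
    adj     : Fin n → Fin n → Bool
    adj-sym : ∀ i j → adj i j ≡ adj j i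
    adj-irr : ∀ i → adj i i ≡ false
open Graph public

degree : ∀ {n} → Graph n → Fin n → ℕ
degree {n} G i = sum (map (λ j → if adj G i j then 1 else 0) (allFin n))

Seq : ℕ → Set
Seq n = Fin n → ℕ

Nonincreasing : ∀ {n} → Seq n → Set
Nonincreasing {n} π = ∀ (i j : Fin n) → i ≤ᶠ j → π j ≤ π i

Realizes : ∀ {n} → Graph n → Seq n → Set
Realizes {n} G π = ∀ (i : Fin n) → degree G i ≡ π i

Graphic : ∀ {n} → Seq n → Set
Graphic {n} π = Nonincreasing π × Σ (Graph n) (λ G → Realizes G π)

SubgraphOf : ∀ {k n} → Graph k → Graph n → Set
SubgraphOf {k} {n} H G =
  Σ (Fin k → Fin n) (λ f → Injective _≡_ _≡_ f ×
     (∀ i j → adj H i j ≡ true → adj G (f i) (f j) ≡ true))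

PotentiallyGraphic : ∀ {k} → Graph k → ∀ {n} → Seq n → Set
PotentiallyGraphic H {n} π =
  Graphic π × Σ (Graph n) (λ G → Realizes G π × SubgraphOf H G)

complementSeq : ∀ {N} → Seq N → Seq N
complementSeq {N} π i = (N ∸ 1) ∸ π (opposite i)

RamseyProp : ∀ {k l} → Graph k → Graph l → ℕ → Set
RamseyProp H₁ H₂ N = ∀ (π : Seq N) → Graphic π →
  PotentiallyGraphic H₁ π ⊎ PotentiallyGraphic H₂ (complementSeq π)

IsPotRamsey : ∀ {k l} → Graph k → Graph l → ℕ → Set
IsPotRamsey H₁ H₂ N = RamseyProp H₁ H₂ N × (∀ M → M < N → ¬ RamseyProp H₁ H₂ M)

eqᵇ : ∀ {n} → Fin n → Fin n → Bool
eqᵇ i j = ⌊ i ≟ j ⌋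

eqᵇ-sym : ∀ {n} (i j : Fin n) → eqᵇ i j ≡ eqᵇ j i
eqᵇ-sym i j with i ≟ j | j ≟ i
... | Relation.Nullary.yes _ | Relation.Nullary.yes _ = refl
... | Relation.Nullary.no _  | Relation.Nullary.no _  = refl
... | Relation.Nullary.yes p | Relation.Nullary.no q  = Data.Empty.⊥-elim (q (sym p))
... | Relation.Nullary.no p  | Relation.Nullary.yes q = Data.Empty.⊥-elim (p (sym q))

eqᵇ-refl : ∀ {n} (i : Fin n) → eqᵇ i i ≡ true
eqᵇ-refl i with i ≟ i
... | Relation.Nullary.yes _ = refl
... | Relation.Nullary.no ¬p = Data.Empty.⊥-elim (¬p refl)

K : (s : ℕ) → Graph s
K s = record
  { adj     = λ i j → not (eqᵇ i j)
  ; adj-sym = λ i j → cong not (eqᵇ-sym i j)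
  ; adj-irr = λ i → cong not (eqᵇ-refl i)
  }

starAdj : ∀ {t} → Fin t → Fin t → Bool
starAdj fzero fzero = false
starAdj fzero (Fin.suc _) = true
starAdj (Fin.suc _) fzero = true
starAdj (Fin.suc _) (Fin.suc _) = false

starAdj-sym : ∀ {t} (i j : Fin t) → starAdj i j ≡ starAdj j i
starAdj-sym fzero fzero = refl
starAdj-sym fzero (Fin.suc _) = refl
starAdj-sym (Fin.suc _) fzero = refl
starAdj-sym (Fin.suc _) (Fin.suc _) = refl

starAdj-irr : ∀ {t} (i : Fin t) → starAdj i i ≡ false
starAdj-irr fzero = refl
starAdj-irr (Fin.suc _) = refl

Star : (t : ℕ) → Graph t
Star t = record { adj = starAdj ; adj-sym = starAdj-sym ; adj-irr = starAdj-irr }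

rpotValue : ℕ → ℕ → ℕ
rpotValue s t = if t <ᵇ s + 2 then 2 * s else t + s ∸ 2

{-# OPTIONS --safe #-}

-- Upper bound.  If no vertex reaches degree t - 1 in the complement, write N = s + n with
-- n ≥ s and pass to the complementary degrees r; they are at most n, and we need a
-- realization of r in which the s vertices of smallest degree form an independent set S.
-- With T the remaining n vertices and some ρ with r ≤ ρ on S and ρ ≤ r on T, let K be the
-- vertices of T of degree above ρ.  Switching lets us delete either a vertex u of S with
-- r(u) ≤ |K|, joined to K only, or (if n > s) the largest vertex of K, joined to the rest
-- of K first and then to the vertices of degree ρ in S; both preserve the hypotheses.
-- When neither applies, joining the vertices of S one after another to the currently
-- largest entries of T flattens T, and nearly constant sequences are graphic.
--
-- Lower bound.  The join of K_{s-2} with an independent set has too few vertices of degree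
-- s - 1 for a K_s, and if the complement is 2-regular on fewer than 2s vertices, counting
-- the 2s non-edges that leave a K_s gives a contradiction.

module Submission where

open import Defs
open import Data.Nat using (ℕ; zero; suc; pred; _+_; _*_; _∸_; _≤_; _<_; z≤n; s≤s; s≤s⁻¹; _<ᵇ_)
open import Data.Nat.Properties
open import Data.Nat.Divisibility using (_∣_; divides; ∣m∣n⇒∣m+n; ∣m+n∣m⇒∣n; m∣m*n; n∣m*n)
open import Data.Nat.ListAction using (sum)
open import Data.Nat.ListAction.Properties using (sum-++; sum-↭)
open import Data.Nat.Tactic.RingSolver using (solve-∀)
open import Data.List using (List; []; _∷_; _++_; length; map; replicate; tabulate)
open import Data.List.Properties using (length-++; length-replicate; length-map; ++-assoc; ++-identityʳ)
open import Data.List.Relation.Unary.All as All using (All; []; _∷_)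
import Data.List.Relation.Unary.All.Properties as All
open import Data.List.Relation.Binary.Permutation.Propositional
  using (_↭_; prep; swap; trans; ↭-refl; ↭-sym; ↭-trans; ↭-reflexive)
open import Data.List.Relation.Binary.Permutation.Propositional.Properties
  using (↭-length; shift; shifts; ++⁺; ++⁺ˡ; ++⁺ʳ; All-resp-↭) renaming (++-comm to ↭-++-comm)
open import Data.List.Membership.Propositional using (_∈_; find)
open import Data.List.Membership.Propositional.Properties using (∈-∃++)
open import Data.List.Relation.Unary.Any using (any?)
open import Data.Product using (∃-syntax; _×_; _,_; proj₁; proj₂)
open import Data.Sum using (_⊎_; inj₁; inj₂)
open import Data.Empty using (⊥; ⊥-elim)
open import Relation.Nullary using (¬_; yes; no; contradiction; ⌊_⌋)
open import Relation.Binary.PropositionalEquality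
  using (_≡_; _≢_; refl; sym; cong; cong₂; subst; subst₂; module ≡-Reasoning) renaming (trans to ≡-trans)
open import Algebra.Properties.CommutativeMonoid.Sum +-0-commutativeMonoid
  using (sum-cong-≗; sum-remove; ∑-comm; ∑-distrib-+; sum-replicate-zero) renaming (sum to ∑)
open import Data.Bool using (Bool; true; false; not; if_then_else_; _∨_) renaming (T to True)
open import Data.Unit using (tt)
open import Data.Fin using (Fin; zero; suc; toℕ; opposite; punchOut; _↑ˡ_; _↑ʳ_; fromℕ; fromℕ<)
import Data.Fin.Properties as Fin
open import Data.List.Properties using (map-tabulate; tabulate-cong; ∷-injectiveˡ; ∷-injectiveʳ; length-tabulate)
open import Data.Vec.Functional using (removeAt) renaming (_∷_ to _◂_)
open import Data.Vec.Functional.Properties using (removeAt-punchOut)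
open import Function using (_∘_; id)
open import Function.Definitions using (Injective)

private
  variable
    a b c l m n p q x y : ℕ
    A B L M Q S T A′ B′ L′ S′ T′ : List ℕ

-- Deletion of one vertex, as a relation on degree lists.

-- Lay c L M relates the degrees L of a graph on the old vertices to the degrees M that
-- remain after deleting a further vertex adjacent to c of them.
data Lay : ℕ → List ℕ → List ℕ → Set where
  []   : Lay 0 [] []
  skip : Lay c L M → Lay c (x ∷ L) (x ∷ M)
  take : Lay c L M → Lay (suc c) (suc x ∷ L) (x ∷ M)

lay-none : ∀ L → Lay 0 L L
lay-none []      = []
lay-none (x ∷ L) = skip (lay-none L)

lay-zero : Lay 0 L M → M ≡ L
lay-zero []       = refl
lay-zero (skip l) = cong (_ ∷_) (lay-zero l)

lay-map-suc : ∀ A → Lay (length A) (map suc A) A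
lay-map-suc []      = []
lay-map-suc (x ∷ A) = take (lay-map-suc A)

lay-replicate : ∀ c x → Lay c (replicate c (suc x)) (replicate c x)
lay-replicate zero    x = []
lay-replicate (suc c) x = take (lay-replicate c x)

lay-length : Lay c L M → length M ≡ length L
lay-length []       = refl
lay-length (skip l) = cong suc (lay-length l)
lay-length (take l) = cong suc (lay-length l)

lay-≤length : Lay c L M → c ≤ length L
lay-≤length []       = z≤n
lay-≤length (skip l) = m≤n⇒m≤1+n (lay-≤length l)
lay-≤length (take l) = s≤s (lay-≤length l)

lay-sum : Lay c L M → sum L ≡ c + sum M
lay-sum []                       = refl
lay-sum {c} (skip {M = M} {x} l) rewrite lay-sum l = lemma x c (sum M)
  where
  lemma : ∀ x c s → x + (c + s) ≡ c + (x + s)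
  lemma = solve-∀
lay-sum (take {c} {M = M} {x} l) rewrite lay-sum l = cong suc (lemma x c (sum M))
  where
  lemma : ∀ x c s → x + (c + s) ≡ c + (x + s)
  lemma = solve-∀

lay-++ : Lay a A A′ → Lay b B B′ → Lay (a + b) (A ++ B) (A′ ++ B′)
lay-++ []       k = k
lay-++ (skip l) k = skip (lay-++ l k)
lay-++ (take l) k = take (lay-++ l k)

lay-++ˡ : ∀ B → Lay a A A′ → Lay a (A ++ B) (A′ ++ B)
lay-++ˡ {a} B l = subst (λ a → Lay a _ _) (+-identityʳ a) (lay-++ l (lay-none B))

lay-++⁻ : ∀ A → Lay c (A ++ B) M →
          ∃[ a ] ∃[ b ] ∃[ A′ ] ∃[ B′ ] c ≡ a + b × M ≡ A′ ++ B′ × Lay a A A′ × Lay b B B′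
lay-++⁻ []      l = _ , _ , _ , _ , refl , refl , [] , l
lay-++⁻ (x ∷ A) (skip l) with a , b , A′ , B′ , p , q , k , k′ ← lay-++⁻ A l =
  a , b , x ∷ A′ , B′ , p , cong (x ∷_) q , skip k , k′
lay-++⁻ (suc x ∷ A) (take l) with a , b , A′ , B′ , p , q , k , k′ ← lay-++⁻ A l =
  suc a , b , x ∷ A′ , B′ , cong suc p , cong (x ∷_) q , take k , k′

lay-≤ : Lay c L M → All (_≤ n) L → All (_≤ n) M
lay-≤ []       []       = []
lay-≤ (skip l) (p ∷ ps) = p ∷ lay-≤ l ps
lay-≤ (take l) (p ∷ ps) = <⇒≤ p ∷ lay-≤ l ps

lay-≥pred : Lay c L M → All (n ≤_) L → All (pred n ≤_) M
lay-≥pred []       []       = []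
lay-≥pred (skip l) (p ∷ ps) = ≤-trans pred[n]≤n p ∷ lay-≥pred l ps
lay-≥pred (take l) (p ∷ ps) = pred-mono-≤ p ∷ lay-≥pred l ps

lay-full-≤ : Lay (length L) L M → All (_≤ n) L → All (_≤ pred n) M
lay-full-≤ []       []       = []
lay-full-≤ (skip l) _        = contradiction (lay-≤length l) 1+n≰n
lay-full-≤ (take l) (p ∷ ps) = <⇒≤pred p ∷ lay-full-≤ l ps

-- The two deleted vertices are taken as nonadjacent, so each keeps its neighbours whichever goes
-- first.
lay-comm : Lay a L M → Lay b M Q → ∃[ M′ ] Lay b L M′ × Lay a M′ Q
lay-comm []       []       = _ , [] , []
lay-comm (skip l) (skip k) with _ , k′ , l′ ← lay-comm l k = _ , skip k′ , skip l′
lay-comm (skip l) (take k) with _ , k′ , l′ ← lay-comm l k = _ , take k′ , skip l′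
lay-comm (take l) (skip k) with _ , k′ , l′ ← lay-comm l k = _ , skip k′ , take l′
lay-comm (take l) (take k) with _ , k′ , l′ ← lay-comm l k = _ , take k′ , take l′

-- The neighbourhood of the second deleted vertex is larger than that of the first, so one of
-- its private neighbours can be handed over.
lay-transfer : a ≤ b → Lay a L M → Lay (suc b) M Q → ∃[ M′ ] Lay (suc a) L M′ × Lay b M′ Q
lay-transfer a≤b (skip l) (skip k) with _ , l′ , k′ ← lay-transfer a≤b l k = _ , skip l′ , skip k′
lay-transfer a≤b (skip l) (take k) = _ , take l , skip k
lay-transfer a≤b (take l) (skip k)
  with _ , l′ , k′ ← lay-transfer (<⇒≤ a≤b) l k = _ , take l′ , skip k′
lay-transfer (s≤s a≤b) (take l) (take k)
  with _ , l′ , k′ ← lay-transfer a≤b l k = _ , take l′ , take k′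

lay-↭ : Lay c L M → L ↭ L′ → ∃[ M′ ] Lay c L′ M′ × M ↭ M′
lay-↭ l                 _↭_.refl       = _ , l , ↭-refl
lay-↭ (skip l)          (prep x p)     with _ , l′ , q ← lay-↭ l p = _ , skip l′ , prep _ q
lay-↭ (take l)          (prep x p)     with _ , l′ , q ← lay-↭ l p = _ , take l′ , prep _ q
lay-↭ (skip (skip l))   (swap x y p)   with _ , l′ , q ← lay-↭ l p = _ , skip (skip l′) , swap _ _ q
lay-↭ (skip (take l))   (swap x y p)   with _ , l′ , q ← lay-↭ l p = _ , take (skip l′) , swap _ _ q
lay-↭ (take (skip l))   (swap x y p)   with _ , l′ , q ← lay-↭ l p = _ , skip (take l′) , swap _ _ q
lay-↭ (take (take l))   (swap x y p)   with _ , l′ , q ← lay-↭ l p = _ , take (take l′) , swap _ _ q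
lay-↭ l                 (trans p₁ p₂)
  with _ , l₁ , q₁ ← lay-↭ l p₁
  with _ , l₂ , q₂ ← lay-↭ l₁ p₂ = _ , l₂ , ↭-trans q₁ q₂

-- Degree lists of graphs.

-- Gr L: L is, in this order, the degree sequence of a graph.
infixr 5 _∷ᵍ_
data Gr : List ℕ → Set where
  []   : Gr []
  _∷ᵍ_ : Lay c L M → Gr M → Gr (c ∷ L)

-- The head of the first layer tells whether the two vertices are adjacent; `lay-comm` reorders the
-- rest.
gr-swap : Gr (a ∷ b ∷ L) → Gr (b ∷ a ∷ L)
gr-swap (skip l ∷ᵍ k ∷ᵍ g) with _ , k′ , l′ ← lay-comm l k = skip k′ ∷ᵍ l′ ∷ᵍ g
gr-swap (take l ∷ᵍ k ∷ᵍ g) with _ , k′ , l′ ← lay-comm l k = take k′ ∷ᵍ l′ ∷ᵍ g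

-- The permutation returned by `lay-↭` is not a subterm of the given one, so the recursion also uses
-- a bound `n` on the length.
gr-↭′ : ∀ n → length L ≤ n → L ↭ L′ → Gr L → Gr L′
gr-↭′ n       h _↭_.refl      g = g
gr-↭′ (suc n) (s≤s h) (prep x p) (l ∷ᵍ g) with _ , l′ , q ← lay-↭ l p =
  l′ ∷ᵍ gr-↭′ n (≤-trans (≤-reflexive (lay-length l)) h) q g
gr-↭′ (suc n) (s≤s h) (swap x y p) g with l ∷ᵍ g′ ← gr-swap g with _ , l′ , q ← lay-↭ l (prep x p) =
  l′ ∷ᵍ gr-↭′ n (≤-trans (≤-reflexive (lay-length l)) h) q g′
gr-↭′ n       h (trans p₁ p₂) g =
  gr-↭′ n (≤-trans (≤-reflexive (sym (↭-length p₁))) h) p₂ (gr-↭′ n h p₁ g)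

gr-↭ : L ↭ L′ → Gr L → Gr L′
gr-↭ = gr-↭′ _ ≤-refl

-- The vertex of degree `suc b` has a neighbour that the other lacks; handing it over changes no
-- further degree.
gr-transfer : a ≤ b → Gr (a ∷ suc b ∷ L) → Gr (suc a ∷ b ∷ L)
gr-transfer a≤b (skip l ∷ᵍ k ∷ᵍ g)
  with _ , l′ , k′ ← lay-transfer a≤b l k = skip l′ ∷ᵍ k′ ∷ᵍ g
gr-transfer (s≤s a≤b) (take l ∷ᵍ k ∷ᵍ g)
  with _ , l′ , k′ ← lay-transfer a≤b l k = take l′ ∷ᵍ k′ ∷ᵍ g


-- Switching neighbours towards larger degrees.

lay-free : ∀ {P : ℕ → Set} → Lay a A A′ → a < length A → All P A →
           ∃[ x ] ∃[ R ] P x × A′ ↭ x ∷ R ×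
             (∀ {y} → x ≡ suc y → ∃[ A″ ] Lay (suc a) A A″ × A″ ↭ y ∷ R)
lay-free (skip l) _       (p ∷ _)  = _ , _ , p , ↭-refl , λ where refl → _ , take l , ↭-refl
lay-free (take l) (s≤s h) (_ ∷ ps)
  with x , R , px , q , f ← lay-free l h ps =
  x , _ ∷ R , px , trans (prep _ q) (swap _ _ ↭-refl) ,
  λ eq → let _ , l′ , q′ = f eq in _ , take l′ , trans (prep _ q′) (swap _ _ ↭-refl)

-- With `lay-free` this supplies the two ends of a switch: a non-neighbour to gain and a neighbour
-- to give up, each before and after. `P` carries the bound by `ρ`.
lay-taken : ∀ {P : ℕ → Set} → Lay (suc b) B B′ → All P B →
            ∃[ z ] ∃[ R ] P (suc z) × B′ ↭ z ∷ R × ∃[ B″ ] Lay b B B″ × B″ ↭ suc z ∷ R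
lay-taken (take l) (p ∷ _)  = _ , _ , p , ↭-refl , _ , skip l , ↭-refl
lay-taken {b = zero} (skip l) (_ ∷ ps)
  with z , R , pz , q , _ , l′ , q′ ← lay-taken l ps =
  z , _ ∷ R , pz , trans (prep _ q) (swap _ _ ↭-refl) ,
  _ , skip l′ , trans (prep _ q′) (swap _ _ ↭-refl)
lay-taken {b = suc b} (skip l) (_ ∷ ps)
  with z , R , pz , q , _ , l′ , q′ ← lay-taken l ps =
  z , _ ∷ R , pz , trans (prep _ q) (swap _ _ ↭-refl) ,
  _ , skip l′ , trans (prep _ q′) (swap _ _ ↭-refl)

↭-heads : ∀ {x z R Q} P → A ↭ x ∷ R → B ↭ z ∷ Q → A ++ B ++ P ↭ z ∷ x ∷ R ++ Q ++ P
↭-heads {x = x} {z} {R} {Q} P p q =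
  trans (++⁺ p (++⁺ʳ P q)) (trans (prep x (shift z R (Q ++ P))) (swap x z ↭-refl))

-- A neighbour in B of the deleted vertex is no larger than a non-neighbour in A, so
-- gr-transfer trades it for the latter, until A or B offers no further choice.
gr-dominate : ∀ {ρ} b {P} → Lay a A A′ → Lay b B B′ → All (ρ ≤_) A → All (_≤ ρ) B →
              Gr (A′ ++ B′ ++ P) →
              ∃[ A″ ] ∃[ B″ ] Gr (A″ ++ B″ ++ P) ×
                (Lay (a + b) A A″ × B″ ≡ B
                 ⊎ ∃[ y ] a + b ≡ length A + y × Lay (length A) A A″ × Lay y B B″)
gr-dominate {a = a} zero l k _ _ g with refl ← lay-zero k =
  _ , _ , g , inj₁ (subst (λ a → Lay a _ _) (sym (+-identityʳ a)) l , refl)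
gr-dominate {a = a} {A = A} (suc b) {P} l k A≥ B≤ g with m≤n⇒m<n∨m≡n (lay-≤length l)
... | inj₂ refl = _ , _ , g , inj₂ (suc b , refl , l , k)
... | inj₁ a<
  with x , R , ρ≤x , p , f ← lay-free l a< A≥
  with z , Q , z<ρ , q , _ , k′ , q′ ← lay-taken k B≤
  with x | ≤-trans z<ρ ρ≤x
-- The neighbour in `B` has `z < ρ` edges left and the non-neighbour in `A` at least `ρ`, so the
-- latter can pass one on and become the new neighbour.
... | suc y | s≤s z≤y
  with _ , l′ , p′ ← f refl
  with A″ , B″ , g′ , r ← gr-dominate b l′ k′ A≥ B≤
         (gr-↭ (↭-sym (↭-heads P p′ q′)) (gr-transfer z≤y (gr-↭ (↭-heads P p q) g)))
  rewrite +-suc a b = A″ , B″ , g′ , r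

-- Degree lists with a prescribed independent set.

-- SR S T: some graph with degree sequence S ++ T has the vertices of S independent.
data SR : List ℕ → List ℕ → Set where
  []   : Gr T → SR [] T
  _∷_ : Lay c T T′ → SR S T′ → SR (c ∷ S) T

sr-↭ʳ : T ↭ T′ → SR S T → SR S T′
sr-↭ʳ p ([] g)  = [] (gr-↭ p g)
sr-↭ʳ p (l ∷ r) with _ , l′ , q ← lay-↭ l p = l′ ∷ sr-↭ʳ q r

sr-↭ˡ : S ↭ S′ → SR S T → SR S′ T
sr-↭ˡ _↭_.refl      r           = r
sr-↭ˡ (prep x p)    (l ∷ r)     = l ∷ sr-↭ˡ p r
sr-↭ˡ (swap x y p)  (l ∷ k ∷ r) with _ , k′ , l′ ← lay-comm l k = k′ ∷ l′ ∷ sr-↭ˡ p r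
sr-↭ˡ (trans p₁ p₂) r           = sr-↭ˡ p₂ (sr-↭ˡ p₁ r)

-- Restores a deleted vertex of `T` with `a` edges into `S` and `b` into `T`: its layer is commuted
-- past those of `S`, each of which takes or skips it.
sr-add : Lay a S S′ → Lay b T T′ → SR S′ T′ → SR S ((a + b) ∷ T)
sr-add []       k ([] g)  = [] (k ∷ᵍ g)
sr-add (skip l) k (m ∷ r) with _ , m′ , k′ ← lay-comm k m = skip m′ ∷ sr-add l k′ r
sr-add (take l) k (m ∷ r) with _ , m′ , k′ ← lay-comm k m = take m′ ∷ sr-add l k′ r

-- Parity and bounds for degree sums.

2∣-double+ : ∀ c {m} → 2 ∣ c + (c + m) → 2 ∣ m
2∣-double+ c {m} h = ∣m+n∣m⇒∣n {2} {2 * c} (subst (2 ∣_) (lemma c m) h) (m∣m*n c)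
  where
  lemma : ∀ c m → c + (c + m) ≡ 2 * c + m
  lemma = solve-∀

double+-2∣ : ∀ c {m} → 2 ∣ m → 2 ∣ c + (c + m)
double+-2∣ c {m} h = subst (2 ∣_) (lemma c m) (∣m∣n⇒∣m+n (m∣m*n c) h)
  where
  lemma : ∀ c m → 2 * c + m ≡ c + (c + m)
  lemma = solve-∀

gr-even : Gr L → 2 ∣ sum L
gr-even []       = divides 0 refl
gr-even (_∷ᵍ_ {c} l g) rewrite lay-sum l = double+-2∣ c (gr-even g)

gr-sum≤ : Gr L → sum L ≤ length L * (length L ∸ 1)
gr-sum≤ []             = z≤n
gr-sum≤ (_∷ᵍ_ {c} {L} {M} l g) rewrite lay-sum l = begin
  c + (c + sum M)                 ≤⟨ +-mono-≤ c≤ (+-mono-≤ c≤ (gr-sum≤ g)) ⟩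
  ℓ + (ℓ + length M * (length M ∸ 1)) ≡⟨ cong (λ m → ℓ + (ℓ + m * (m ∸ 1))) (lay-length l) ⟩
  ℓ + (ℓ + ℓ * (ℓ ∸ 1))           ≡⟨ lemma ℓ ⟩
  suc ℓ * ℓ                       ∎
  where
  open ≤-Reasoning
  ℓ = length L
  c≤ = lay-≤length l
  lemma : ∀ ℓ → ℓ + (ℓ + ℓ * (ℓ ∸ 1)) ≡ suc ℓ * ℓ
  lemma zero    = refl
  lemma (suc ℓ) = ring ℓ
    where
    ring : ∀ ℓ → suc ℓ + (suc ℓ + suc ℓ * ℓ) ≡ suc (suc ℓ) * suc ℓ
    ring = solve-∀

-- An inequality of Erdős-Gallai type: edges leaving `T` are paid for by their ends in `S`, and the
-- others lie inside `T`.
gr-sum-++≤ : ∀ S → Gr (S ++ T) → sum T ≤ sum S + length T * (length T ∸ 1)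
gr-sum-++≤ []      g        = gr-sum≤ g
gr-sum-++≤ {T} (u ∷ S) (l ∷ᵍ g)
  with a , b , S′ , T′ , refl , refl , k , k′ ← lay-++⁻ S l
  rewrite lay-sum k | lay-sum k′ = begin
  b + sum T′                            ≤⟨ +-monoʳ-≤ b (gr-sum-++≤ S′ g) ⟩
  b + (sum S′ + length T′ * (length T′ ∸ 1)) ≡⟨ cong (λ m → b + (sum S′ + m * (m ∸ 1))) (lay-length k′) ⟩
  b + (sum S′ + N)                      ≤⟨ m≤n+m _ (a + a) ⟩
  a + a + (b + (sum S′ + N))            ≡⟨ lemma a b (sum S′) N ⟩
  a + b + (a + sum S′) + N              ∎
  where
  open ≤-Reasoning
  N = length T * (length T ∸ 1)
  lemma : ∀ a b s n → a + a + (b + (s + n)) ≡ a + b + (a + s) + n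
  lemma = solve-∀

-- Nearly constant sequences.

replicate-+ : ∀ {X : Set} m n {x : X} → replicate (m + n) x ≡ replicate m x ++ replicate n x
replicate-+ zero    n = refl
replicate-+ (suc m) n = cong (_ ∷_) (replicate-+ m n)

sum-replicate : ∀ n x → sum (replicate n x) ≡ n * x
sum-replicate zero    x = refl
sum-replicate (suc n) x = cong (x +_) (sum-replicate n x)

flat : ℕ → ℕ → ℕ → List ℕ
flat p q l = replicate p (suc l) ++ replicate q l

sum-flat : ∀ p q l → sum (flat p q l) ≡ p + (p + q) * l
sum-flat p q l rewrite sum-++ (replicate p (suc l)) (replicate q l)
                     | sum-replicate p (suc l) | sum-replicate q l = lemma p q l
  where
  lemma : ∀ p q l → p * suc l + q * l ≡ p + (p + q) * l
  lemma = solve-∀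

flat-drop : ∀ c e q l → ∃[ M ] Lay c (flat (c + e) q l) M × M ↭ flat e (c + q) l
flat-drop c e q l rewrite replicate-+ c e {suc l} | replicate-+ c q {l} =
  _ , lay-++ˡ _ (lay-++ˡ _ (lay-replicate c l)) ,
  trans (↭-reflexive (++-assoc (replicate c l) (replicate e (suc l)) (replicate q l)))
        (shifts (replicate c l) (replicate e (suc l)))

-- Once all larger entries are taken, `d` smaller ones follow; the `e` entries left alone belong to
-- the upper block one level down.
flat-drop-all : p ≤ c → c ≤ p + q →
                ∃[ d ] ∃[ e ] ∃[ M ] c ≡ p + d × q ≡ d + e × Lay c (flat p q (suc l)) M × M ↭ flat (p + e) d l
flat-drop-all {p} {l = l} p≤c c≤
  with d , refl ← m≤n⇒∃[o]m+o≡n p≤c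
  with e , refl ← m≤n⇒∃[o]m+o≡n (+-cancelˡ-≤ p _ _ c≤)
  rewrite replicate-+ d e {suc l} =
  d , e , _ , refl , refl , lay-++ (lay-replicate p (suc l)) (lay-++ˡ _ (lay-replicate d l)) ,
  trans (++⁺ˡ (replicate p (suc l)) (↭-++-comm (replicate d l) (replicate e (suc l))))
        (↭-reflexive (sym (≡-trans (cong (_++ replicate d l) (replicate-+ p e))
                                   (++-assoc (replicate p (suc l)) _ _))))

even-tail : Lay c L M → M ↭ L′ → 2 ∣ c + sum L → 2 ∣ sum L′
even-tail {c} l p h rewrite lay-sum l = subst (2 ∣_) (sum-↭ p) (2∣-double+ c h)

-- Havel-Hakimi: joining a vertex of largest degree to the largest others leaves a flat sequence.
-- The bound on `suc l` is asked for only if that value occurs.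
gr-flat : ∀ n p q l → p + q ≤ n → (0 < p → suc l < p + q) → (0 < p + q → l < p + q) →
          2 ∣ sum (flat p q l) → Gr (flat p q l)
gr-flat n       zero    zero    l       _ _  _  _ = []
gr-flat (suc n) zero    (suc q) zero    h _  _  ev =
  lay-none _ ∷ᵍ gr-flat n 0 q 0 (s≤s⁻¹ h) (λ ()) (λ 0<q → 0<q) ev
gr-flat (suc n) zero    (suc q) (suc l) h _  h₂ ev
  with _ , e , M , refl , refl , k , r ← flat-drop-all {0} {suc l} {q} {l} z≤n (s≤s⁻¹ (h₂ (s≤s z≤n))) =
  k ∷ᵍ gr-↭ (↭-sym r)
         (gr-flat n e (suc l) l (≤-trans (≤-reflexive (+-comm e (suc l))) (s≤s⁻¹ h))
            (m<n+m (suc l)) (λ _ → m≤n+m (suc l) e) (even-tail k r ev))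
gr-flat (suc n) (suc p) q       l       h h₁ h₂ ev with ≤-<-connex (suc l) p
... | inj₁ l<p
  with e , refl ← m≤n⇒∃[o]m+o≡n l<p
  with M , k , r ← flat-drop (suc l) e q l =
  k ∷ᵍ gr-↭ (↭-sym r)
         (gr-flat n e (suc l + q) l (≤-trans (≤-reflexive (lemma e (suc l) q)) (s≤s⁻¹ h))
            (λ 0<e → ≤-trans (m<n+m (suc l) 0<e) (+-monoʳ-≤ e (m≤m+n (suc l) q)))
            (λ _ → m≤n⇒m≤o+n e (m≤m+n (suc l) q)) (even-tail k r ev))
  where
  lemma : ∀ e l q → e + (l + q) ≡ l + e + q
  lemma = solve-∀
-- A single 1 among zeros has odd sum.
gr-flat (suc n) 1             q zero _ _ _ ev | inj₂ _ =
  contradiction (subst (2 ∣_) (cong suc (≡-trans (sum-replicate q 0) (*-zeroʳ q))) ev)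
    λ where (divides (suc k) ())
gr-flat (suc n) (suc (suc p)) q zero _ _ _ _  | inj₂ (s≤s ())
gr-flat (suc n) (suc p) q (suc l) h h₁ h₂ ev | inj₂ p≤
  with d , e , M , _ , refl , k , r ← flat-drop-all {l = l} (<⇒≤ p≤) (s≤s⁻¹ (h₁ (s≤s z≤n))) =
  k ∷ᵍ gr-↭ (↭-sym r)
         (gr-flat n (p + e) d l (≤-trans (≤-reflexive (lemma p e d)) (s≤s⁻¹ h))
            (λ _ → subst (suc l <_) (sym (lemma p e d)) (s≤s⁻¹ (h₁ (s≤s z≤n))))
            (λ _ → subst (l <_) (sym (lemma p e d)) (<⇒≤ (s≤s⁻¹ (h₁ (s≤s z≤n)))))
            (even-tail k r ev))
  where
  lemma : ∀ p e d → p + e + d ≡ p + (d + e)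
  lemma = solve-∀

-- Flattening `T` by the vertices of `S`.

sum-≤ : All (_≤ n) L → sum L ≤ length L * n
sum-≤ []       = z≤n
sum-≤ (p ∷ ps) = +-mono-≤ p (sum-≤ ps)

sum-≥ : All (n ≤_) L → length L * n ≤ sum L
sum-≥ []       = z≤n
sum-≥ (p ∷ ps) = +-mono-≤ p (sum-≥ ps)

split-≥ : All (n ≤_) L → ∃[ M ] ∃[ j ] L ↭ M ++ replicate j n × All (n <_) M
split-≥ [] = [] , 0 , ↭-refl , []
split-≥ {L = x ∷ _} (n≤x ∷ ps) with M , j , r , qs ← split-≥ ps | m≤n⇒m<n∨m≡n n≤x
... | inj₁ n<x  = x ∷ M , j , prep x r , n<x ∷ qs
... | inj₂ refl = M , suc j , trans (prep x r) (↭-sym (shift x M (replicate j x))) , qs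

split-≤ : All (_≤ n) L → ∃[ M ] ∃[ j ] L ↭ replicate j n ++ M × All (_< n) M
split-≤ [] = [] , 0 , ↭-refl , []
split-≤ {L = x ∷ _} (x≤n ∷ ps) with M , j , r , qs ← split-≤ ps | m≤n⇒m<n∨m≡n x≤n
... | inj₁ x<n  = x ∷ M , j , trans (prep x r) (↭-sym (shift x (replicate j _) M)) , x<n ∷ qs
... | inj₂ refl = M , suc j , prep x r , qs

positive : All (n <_) L → ∃[ M ] L ≡ map suc M × All (n ≤_) M
positive [] = [] , refl , []
positive (s≤s p ∷ ps) with M , refl , qs ← positive ps = _ ∷ M , refl , p ∷ qs

-- Deleting a vertex of `S` with `u` neighbours in `T` lowers both sums by `u`, so their difference
-- and its parity persist.
lay-sums : ∀ {u N} S → Lay u T T′ → T′ ↭ B →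
           u + sum S ≤ sum T → sum T ≤ u + sum S + N → 2 ∣ u + sum S + sum T →
           sum S ≤ sum B × sum B ≤ sum S + N × 2 ∣ sum S + sum B
lay-sums {T′ = T′} {B} {u} {N} S l r h₁ h₂ ev rewrite lay-sum l | sym (sum-↭ r) =
  +-cancelˡ-≤ u _ _ h₁ ,
  +-cancelˡ-≤ u _ _ (subst (u + sum T′ ≤_) (+-assoc u (sum S) N) h₂) ,
  2∣-double+ u (subst (2 ∣_) (lemma u (sum S) (sum T′)) ev)
  where
  lemma : ∀ u s t → u + s + (u + t) ≡ u + (u + (s + t))
  lemma = solve-∀

-- Every vertex of S is joined to all of U, whose entries exceed the flat part, and to the
-- top of the flat part; entries of U that come down to the level l join the flat part.
-- They all do so before S is exhausted because U ≤ |S|.  The sum bounds ensure that no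
-- zero is decremented and that the final flat sequence fits into a complete graph.
sr-spread : ∀ n S U p q l → length U + (p + q) ≡ n →
            All (l <_) U → All (_≤ length S) U → All (length U ≤_) S → All (_≤ n) S →
            sum S ≤ sum (U ++ flat p q l) → sum (U ++ flat p q l) ≤ sum S + n * (n ∸ 1) →
            2 ∣ sum S + sum (U ++ flat p q l) → SR S (U ++ flat p q l)
sr-spread n [] (x ∷ U) p q l _ (l<x ∷ _) (x≤0 ∷ _) _ _ _ _ _ with () ← ≤-trans l<x x≤0
sr-spread n [] [] p q l refl _ _ _ _ _ h ev =
  [] (gr-flat _ p q l ≤-refl (λ 0<p → ≰⇒> (high 0<p)) (λ 0<n → ≰⇒> (low 0<n)) ev)
  where
  open ≤-Reasoning
  bound : p + n * l ≤ n * (n ∸ 1)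
  bound = subst (_≤ n * (n ∸ 1)) (sum-flat p q l) h
  -- The sum bound excludes entries of size `n` or more: `high` treats `suc l`, `low` treats `l`.
  high : 0 < p → ¬ n ≤ suc l
  high 0<p n≤ = <-irrefl refl (begin-strict
    n * (n ∸ 1) ≤⟨ *-monoʳ-≤ n (pred-mono-≤ n≤) ⟩
    n * l       <⟨ m<n+m (n * l) 0<p ⟩
    p + n * l   ≤⟨ bound ⟩
    n * (n ∸ 1) ∎)
  low : 0 < n → ¬ n ≤ l
  low 0<n n≤ = <-irrefl refl (begin-strict
    n * (n ∸ 1) <⟨ *-pred n 0<n ⟩
    n * n       ≤⟨ *-monoʳ-≤ n n≤ ⟩
    n * l       ≤⟨ m≤n+m (n * l) p ⟩
    p + n * l   ≤⟨ bound ⟩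
    n * (n ∸ 1) ∎)
    where
    *-pred : ∀ n → 0 < n → n * (n ∸ 1) < n * n
    *-pred (suc n) _ = *-monoʳ-< (suc n) (n<1+n n)
sr-spread n (u ∷ S) U p q l eq U> U≤ (U≤u ∷ U≤S) (u≤n ∷ S≤n) h₁ h₂ ev
  with c , refl ← m≤n⇒∃[o]m+o≡n U≤u
  with V , refl , V≥ ← positive U>
  with ≤-<-connex c p
... | inj₁ c≤p
  with e , refl ← m≤n⇒∃[o]m+o≡n c≤p
  with M , k , r ← flat-drop c e q l
  with W , j , s , W> ← split-≥ V≥ =
  lay ∷ sr-↭ʳ (↭-sym perm)
    (sr-spread n S W e (j + (c + q)) l len W>
      (All.++⁻ˡ W (All-resp-↭ s (All.map s≤s⁻¹ (All.map⁻ U≤)))) (All.map (≤-trans W≤U) U≤S) S≤n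
      (proj₁ sums) (proj₁ (proj₂ sums)) (proj₂ (proj₂ sums)))
  where
  U′ = map suc V
  lay : Lay (length U′ + c) (U′ ++ flat (c + e) q l) (V ++ M)
  lay = lay-++ (subst (λ x → Lay x U′ V) (sym (length-map suc V)) (lay-map-suc V)) k
  perm : V ++ M ↭ W ++ flat e (j + (c + q)) l
  perm = trans (++⁺ s r) (trans (↭-reflexive (++-assoc W (replicate j l) _))
           (++⁺ˡ W (trans (shifts (replicate j l) (replicate e (suc l)))
             (++⁺ˡ (replicate e (suc l)) (↭-reflexive (sym (replicate-+ j (c + q))))))))
  |U| : length U′ ≡ length W + j
  |U| = ≡-trans (length-map suc V) (≡-trans (↭-length s)
          (≡-trans (length-++ W) (cong (length W +_) (length-replicate j))))
  W≤U : length W ≤ length U′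
  W≤U = subst (length W ≤_) (sym |U|) (m≤m+n (length W) j)
  len : length W + (e + (j + (c + q))) ≡ n
  len = ≡-trans (≡-trans (lemma (length W) e j c q) (cong (_+ (c + e + q)) (sym |U|))) eq
    where
    lemma : ∀ w e j c q → w + (e + (j + (c + q))) ≡ w + j + (c + e + q)
    lemma = solve-∀
  sums = lay-sums S lay perm h₁ h₂ ev
-- At level 0 the sums force `c ≤ p`: each later vertex of `S` has degree at least `length U′`,
-- while no entry of `U′` exceeds `suc (length S)`.
sr-spread n (u ∷ S) U p q zero eq U> U≤ (U≤u ∷ U≤S) (u≤n ∷ S≤n) h₁ h₂ ev
  | inj₂ p<c = contradiction p<c (≤⇒≯ (+-cancelˡ-≤ (length U′ + length S * length U′) c p (begin
    length U′ + length S * length U′ + c   ≡⟨ lemma₁ (length U′) (length S * length U′) c ⟩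
    length U′ + c + length S * length U′   ≤⟨ +-monoʳ-≤ (length U′ + c) (sum-≥ U≤S) ⟩
    length U′ + c + sum S                  ≤⟨ h₁ ⟩
    sum (U′ ++ flat p q 0)                 ≡⟨ sum-++ U′ (flat p q 0) ⟩
    sum U′ + sum (flat p q 0)              ≡⟨ cong (sum U′ +_) (sum-flat p q 0) ⟩
    sum U′ + (p + (p + q) * 0)             ≤⟨ +-monoˡ-≤ _ (sum-≤ U≤) ⟩
    length U′ * suc (length S) + (p + (p + q) * 0) ≡⟨ lemma₂ (length U′) (length S) p q ⟩
    length U′ + length S * length U′ + p   ∎)))
  where
  open ≤-Reasoning
  U′ = map suc V
  lemma₁ : ∀ u s c → u + s + c ≡ u + c + s
  lemma₁ = solve-∀
  lemma₂ : ∀ u s p q → u * suc s + (p + (p + q) * 0) ≡ u + s * u + p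
  lemma₂ = solve-∀
-- The level falls together with the entries of `U`, so none of them merges into the flat part.
sr-spread n (u ∷ S) U p q (suc l) eq U> U≤ (U≤u ∷ U≤S) (u≤n ∷ S≤n) h₁ h₂ ev
  | inj₂ p<c
  with d , e , M , refl , refl , k , r ← flat-drop-all {l = l} (<⇒≤ p<c)
         (+-cancelˡ-≤ (length (map suc V)) _ _ (subst (_ ≤_) (sym eq) u≤n)) =
  lay ∷ sr-↭ʳ (↭-sym perm)
    (sr-spread n S V (p + e) d l len V≥
      (All.map s≤s⁻¹ (All.map⁻ U≤)) (subst (λ x → All (x ≤_) S) (length-map suc V) U≤S) S≤n
      (proj₁ sums) (proj₁ (proj₂ sums)) (proj₂ (proj₂ sums)))
  where
  U′ = map suc V
  lay : Lay (length U′ + (p + d)) (U′ ++ flat p (d + e) (suc l)) (V ++ M)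
  lay = lay-++ (subst (λ x → Lay x U′ V) (sym (length-map suc V)) (lay-map-suc V)) k
  perm : V ++ M ↭ V ++ flat (p + e) d l
  perm = ++⁺ˡ V r
  len : length V + (p + e + d) ≡ n
  len = ≡-trans (cong₂ _+_ (sym (length-map suc V)) (lemma p e d)) eq
    where
    lemma : ∀ p e d → p + e + d ≡ p + (d + e)
    lemma = solve-∀
  sums = lay-sums S lay perm h₁ h₂ ev

-- Deleting vertices while keeping the hypotheses.

record Split (ρ : ℕ) (S T : List ℕ) : Set where
  constructor split
  field
    len : length S ≤ length T
    S≤  : All (_≤ ρ) S
    T≥  : All (ρ ≤_) T
    T≤  : All (_≤ length T) T
    gr  : Gr (S ++ T)
open Split

split-↭ : ∀ {ρ} → S ↭ S′ → T ↭ T′ → Split ρ S T → Split ρ S′ T′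
split-↭ s t h = split
  (subst₂ _≤_ (↭-length s) (↭-length t) (len h))
  (All-resp-↭ s (S≤ h)) (All-resp-↭ t (T≥ h))
  (subst (λ n → All (_≤ n) _) (↭-length t) (All-resp-↭ t (T≤ h)))
  (gr-↭ (++⁺ s t) (gr h))

SplitsUpTo : ℕ → Set
SplitsUpTo f = ∀ {ρ} S T → length S + length T ≤ f → Split ρ S T → SR S T

split-ρ≤ : ∀ {ρ} → 0 < length S → Split ρ S T → ρ ≤ length T
split-ρ≤ {T = []}    0<S h with () ← ≤-trans 0<S (len h)
split-ρ≤ {T = t ∷ T} _   h with p ∷ _ ← T≥ h with q ∷ _ ← T≤ h = ≤-trans p q

-- The end of the deletions. Comparison with multiples of `ρ` bounds `sum S` by the sum of the other
-- side; `gr-sum-++≤` gives the opposite bound.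
sr-of-spread : ∀ {ρ} K q → All (ρ <_) K → All (_≤ length S) K → All (length K <_) S →
               0 < length S → Split ρ S (K ++ replicate q ρ) → SR S (K ++ replicate q ρ)
sr-of-spread {S = S} {ρ} K q K> K≤ S> 0<S h =
  sr-spread (length T₀) S K 0 q ρ
    (sym (≡-trans (length-++ K) (cong (length K +_) (length-replicate q))))
    K> K≤ (All.map <⇒≤ S>) (All.map (λ u≤ → ≤-trans u≤ (split-ρ≤ 0<S h)) (S≤ h))
    (≤-trans (sum-≤ (S≤ h)) (≤-trans (*-monoˡ-≤ ρ (len h)) (sum-≥ (T≥ h))))
    (gr-sum-++≤ S (gr h))
    (subst (2 ∣_) (sum-++ S T₀) (gr-even (gr h)))
  where T₀ = K ++ replicate q ρ

∈-↭ : ∀ {u} → u ∈ S → ∃[ S′ ] S ↭ u ∷ S′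
∈-↭ {u = u} u∈S with xs , ys , refl ← ∈-∃++ u∈S = xs ++ ys , shift u xs ys

-- As `u ≤ length A`, there is room in `A` for every neighbour, and switching can move them all
-- there.
dominate-lay : ∀ {ρ u} → u ≤ length A → All (ρ ≤_) A → All (_≤ ρ) B → Gr (u ∷ A ++ B) →
               ∃[ A′ ] Lay u A A′ × Gr (A′ ++ B)
dominate-lay {A = A} {B} u≤ A≥ B≤ (l ∷ᵍ g)
  with a , b , A₁ , B₁ , refl , refl , k , k′ ← lay-++⁻ A l
  with gr-dominate b k k′ A≥ B≤ (subst (λ L → Gr (A₁ ++ L)) (sym (++-identityʳ B₁)) g)
... | A₂ , B₂ , g′ , inj₁ (k₂ , refl) = A₂ , k₂ , subst (λ L → Gr (A₂ ++ L)) (++-identityʳ B₂) g′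
... | A₂ , B₂ , g′ , inj₂ (zero , eq , k₂ , k₃) with refl ← lay-zero k₃ =
  A₂ , subst (λ c → Lay c A A₂) (sym (≡-trans eq (+-identityʳ _))) k₂ ,
  subst (λ L → Gr (A₂ ++ L)) (++-identityʳ B₂) g′
... | A₂ , B₂ , g′ , inj₂ (suc y , eq , _) =
  contradiction (subst (length A <_) (sym eq) (m<m+n (length A) (s≤s z≤n))) (≤⇒≯ u≤)

-- The neighbours of `u` can be chosen above `ρ`, so losing an edge leaves them at least `ρ`.
sr-remove-S : ∀ {f ρ u} K q → All (ρ <_) K → u ≤ length K → u ∈ S →
              length S + length (K ++ replicate q ρ) ≤ suc f → SplitsUpTo f →
              Split ρ S (K ++ replicate q ρ) → SR S (K ++ replicate q ρ)
sr-remove-S {f = f} {ρ} {u} K q K> u≤ u∈S fuel rec h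
  with S′ , r ← ∈-↭ u∈S
  with h′ ← split-↭ r ↭-refl h
  with _ ∷ S′≤ ← S≤ h′
  with K′ , l , g ← dominate-lay u≤ (All.map <⇒≤ K>) (All.++⁺ S′≤ (All.replicate⁺ q ≤-refl))
                      (gr-↭ (prep u (shifts S′ K)) (gr h′)) =
  sr-↭ˡ (↭-sym r) (l′ ∷ rec S′ (K′ ++ C)
    (s≤s⁻¹ (≤-trans (≤-reflexive (cong₂ _+_ (sym (↭-length r)) |T|)) fuel))
    (split (≤-trans (n≤1+n _) (subst (_ ≤_) (sym |T|) (len h′)))
      S′≤
      (All.++⁺ (lay-≥pred l K>) (All.replicate⁺ q ≤-refl))
      (lay-≤ l′ (subst (λ n → All (_≤ n) (K ++ C)) (sym |T|) (T≤ h)))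
      (gr-↭ (shifts K′ S′) g)))
  where
  C = replicate q ρ
  l′ = lay-++ˡ C l
  |T| = lay-length l′

maximum : ∀ y K → ∃[ x ] ∃[ K′ ] y ∷ K ↭ x ∷ K′ × All (_≤ x) K′
maximum y []      = y , [] , ↭-refl , []
maximum y (z ∷ K) with x , K′ , r , ps ← maximum z K | ≤-total x y
... | inj₁ x≤y = y , z ∷ K , ↭-refl , All-resp-↭ (↭-sym r) (x≤y ∷ All.map (λ p → ≤-trans p x≤y) ps)
... | inj₂ y≤x = x , y ∷ K′ , trans (prep y r) (swap y x ↭-refl) , y≤x ∷ ps

regroup : ∀ (A B C D : List ℕ) → A ++ (B ++ C) ++ D ↭ (A ++ B) ++ D ++ C
regroup A B C D = trans (++⁺ˡ A (trans (↭-reflexive (++-assoc B C D)) (++⁺ˡ B (↭-++-comm C D))))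
                        (↭-reflexive (sym (++-assoc A B (D ++ C))))

-- S = R ++ V with R the entries equal to ρ; the bound is lowered to pred ρ exactly when all
-- of R is used up.
sr-remove-T : ∀ {f ρ x} R V K q → All (_≤ ρ) R → All (_< ρ) V → All (ρ <_) K → All (_≤ x) K → ρ < x →
              length (R ++ V) ≤ length (K ++ replicate q ρ) →
              length (R ++ V) + length (K ++ replicate q ρ) ≤ f → SplitsUpTo f → All (ρ ≤_) R →
              Split ρ (R ++ V) (x ∷ K ++ replicate q ρ) → SR (R ++ V) (x ∷ K ++ replicate q ρ)
sr-remove-T {f} {ρ} {x} R V K q R≤ V< K> K≤x ρ<x len≤ fuel rec R≥ h
  with l ∷ᵍ g ← gr-↭ (trans (shift x (R ++ V) (K ++ replicate q ρ))
                            (prep x (shifts (R ++ V) K))) (gr h)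
  with a , b , K₁ , B₁ , refl , refl , k , k′ ← lay-++⁻ K l
  with gr-dominate b k k′ (All.map <⇒≤ K>)
         (All.++⁺ (S≤ h) (All.replicate⁺ q ≤-refl))
         (subst (λ L → Gr (K₁ ++ L)) (sym (++-identityʳ B₁)) g)
-- All neighbours of `x` lie in `K`. The largest entry `x` is at most the new length of `T` and
-- bounds whatever remains.
... | K₂ , B₂ , g′ , inj₁ (k₂ , refl) =
  sr-add (lay-none (R ++ V)) k₂′
    (rec (R ++ V) (K₂ ++ C) (subst (λ n → length (R ++ V) + n ≤ f) (sym |T|) fuel)
      (split (subst (_ ≤_) (sym |T|) len≤) (S≤ h)
        (All.++⁺ (lay-≥pred k₂ K>) (All.replicate⁺ q ≤-refl))
        (subst (λ n → All (_≤ n) (K₂ ++ C)) (sym |T|)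
          (All.map (λ p → ≤-trans p x≤) (All.++⁺ (lay-≤ k₂ K≤x) (All.replicate⁺ q (<⇒≤ ρ<x)))))
        (gr-↭ (trans (++⁺ˡ K₂ (↭-reflexive (++-identityʳ B₂))) (shifts K₂ (R ++ V))) g′)))
  where
  C = replicate q ρ
  k₂′ = lay-++ˡ C k₂
  |T| = lay-length k₂′
  x≤ : x ≤ length (K ++ C)
  x≤ = lay-≤length k₂′
... | K₂ , B₂ , g′ , inj₂ (y , x≡ , k₂ , m)
  with a′ , b′ , R₁ , D₁ , refl , refl , r , d ← lay-++⁻ R (subst (λ L → Lay y L B₂) (++-assoc R V _) m)
  -- Neighbours that `K` cannot hold go to `R` first, whose entries `ρ` are maximal among the rest.
  with gr-dominate b′ r d R≥ (All.++⁺ (All.map <⇒≤ V<) (All.replicate⁺ q ≤-refl))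
         (gr-↭ (trans (++⁺ˡ K₂ (↭-reflexive (++-identityʳ (R₁ ++ D₁))))
                 (trans (↭-++-comm K₂ (R₁ ++ D₁)) (↭-reflexive (++-assoc R₁ D₁ K₂)))) g′)
-- Every entry of `K` drops along with the length of `T`, and `ρ < x` keeps the copies of `ρ` within
-- the new length.
... | R₂ , D₂ , g″ , inj₁ (r₂ , refl) =
  subst (λ c → SR (R ++ V) (c ∷ K ++ C)) (≡-trans (+-comm (a′ + b′) (length K)) (sym x≡))
    (sr-add s₂ k₂′
      (rec (R₂ ++ V) (K₂ ++ C) (subst₂ (λ m n → m + n ≤ f) (sym |S|) (sym |T|) fuel)
        (split (subst₂ _≤_ (sym |S|) (sym |T|) len≤)
          (lay-≤ s₂ (S≤ h))
          (All.++⁺ (lay-≥pred k₂ K>) (All.replicate⁺ q ≤-refl))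
          (subst (λ n → All (_≤ n) (K₂ ++ C)) (sym |T|)
            (All.++⁺ (lay-full-≤ k₂ (All.++⁻ˡ K (All.tail (T≤ h))))
              (All.replicate⁺ q (s≤s⁻¹ (≤-trans ρ<x (All.head (T≤ h)))))))
          (gr-↭ (regroup R₂ V C K₂) g″))))
  where
  C = replicate q ρ
  k₂′ = lay-++ˡ C k₂
  s₂ = lay-++ˡ V r₂
  |T| = lay-length k₂′
  |S| = lay-length s₂
-- All of `R` has dropped and `V` was already below `ρ`, so `pred ρ` separates the two sides.
... | R₂ , D₂ , g″ , inj₂ (z , eq , r₂ , m₂)
  with c , d , V₂ , C₂ , refl , refl , v₂ , c₂ ← lay-++⁻ V m₂ =
  subst (λ c → SR (R ++ V) (c ∷ K ++ C)) total
    (sr-add s₂ k₂′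
      (rec {pred ρ} (R₂ ++ V₂) (K₂ ++ C₂) (subst₂ (λ m n → m + n ≤ f) (sym |S|) (sym |T|) fuel)
        (split (subst₂ _≤_ (sym |S|) (sym |T|) len≤)
          (All.++⁺ (lay-full-≤ r₂ R≤) (lay-≤ v₂ (All.map <⇒≤pred V<)))
          (All.++⁺ (All.map (≤-trans pred[n]≤n) (lay-≥pred k₂ K>))
                   (lay-≥pred c₂ (All.replicate⁺ q ≤-refl)))
          (subst (λ n → All (_≤ n) (K₂ ++ C₂)) (sym |T|)
            (All.++⁺ (lay-full-≤ k₂ (All.++⁻ˡ K (All.tail (T≤ h))))
              (lay-≤ c₂ (All.replicate⁺ q (s≤s⁻¹ (≤-trans ρ<x (All.head (T≤ h))))))))
          (gr-↭ (regroup R₂ V₂ C₂ K₂) g″))))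
  where
  C = replicate q ρ
  k₂′ = lay-++ k₂ c₂
  s₂ = lay-++ r₂ v₂
  |T| = lay-length k₂′
  |S| = lay-length s₂
  total : length R + c + (length K + d) ≡ a + b
  total = ≡-trans (lemma (length R) c (length K) d) (sym (≡-trans x≡ (cong (length K +_) eq)))
    where
    lemma : ∀ r c k d → r + c + (k + d) ≡ k + (r + (c + d))
    lemma = solve-∀

sr-of-gr : ∀ f → SplitsUpTo f
sr-of-gr f       []       T _    h = [] (gr h)
sr-of-gr (suc f) (v ∷ S₀) T fuel h
  with K , q , t , K> ← split-≥ (T≥ h)
  with h′ ← split-↭ ↭-refl t h
  with fuel′ ← subst (λ n → suc (length S₀ + n) ≤ suc f) (↭-length t) fuel
  with any? (_≤? length K) (v ∷ S₀)
... | yes some with u , u∈S , u≤ ← find some =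
  sr-↭ʳ (↭-sym t) (sr-remove-S K q K> u≤ u∈S fuel′ (sr-of-gr f) h′)
... | no none
  with S> ← All.map ≰⇒> (All.¬Any⇒All¬ (v ∷ S₀) none)
  with m≤n⇒m<n∨m≡n (len h′)
-- With equal lengths `T≤` bounds `K` by `length S`, as spreading requires.
... | inj₂ eq = sr-↭ʳ (↭-sym t) (sr-of-spread K q K>
                  (subst (λ n → All (_≤ n) K) (sym eq) (All.++⁻ˡ K (T≤ h′))) S> (s≤s z≤n) h′)
-- Here `T` can lose a vertex and still be at least as long as `S`.
... | inj₁ S<T with K
...   | []    = sr-↭ʳ (↭-sym t) (sr-of-spread [] q [] [] S> (s≤s z≤n) h′)
...   | y ∷ K₀
  with x , K′ , k , K′≤ ← maximum y K₀
  with V , j , s , V< ← split-≤ (S≤ h′)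
  with ρ<x ∷ K′> ← All-resp-↭ k K> =
  sr-↭ˡ (↭-sym s) (sr-↭ʳ (↭-sym t′)
    (sr-remove-T (replicate j _) V K′ q (All.replicate⁺ j ≤-refl) V< K′> K′≤ ρ<x
      (subst (_≤ length (K′ ++ C)) (↭-length s) (s≤s⁻¹ (subst (length (v ∷ S₀) <_) |T| S<T)))
      (subst (λ m → m + length (K′ ++ C) ≤ f) (↭-length s)
        (≤-trans (≤-reflexive (sym (+-suc (length S₀) _)))
          (s≤s⁻¹ (subst (λ n → suc (length S₀ + n) ≤ suc f) |T| fuel′))))
      (sr-of-gr f) (All.replicate⁺ j ≤-refl)
      (split-↭ s t′ h)))
  where
  C = replicate q _
  t′ = trans t (++⁺ʳ C k)
  |T| = ↭-length (++⁺ʳ C k)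

-- Degrees as finite sums, and complements.

bit : Bool → ℕ
bit b = if b then 1 else 0

deg : ∀ {n} → Graph n → Fin n → ℕ
deg G i = ∑ (bit ∘ adj G i)

sum-tabulate : ∀ {n} (w : Fin n → ℕ) → sum (tabulate w) ≡ ∑ w
sum-tabulate {zero}  w = refl
sum-tabulate {suc n} w = cong (w zero +_) (sum-tabulate (w ∘ suc))

degree≡deg : ∀ {n} (G : Graph n) i → degree G i ≡ deg G i
degree≡deg G i = ≡-trans (cong sum (map-tabulate id (bit ∘ adj G i))) (sum-tabulate (bit ∘ adj G i))

∑-const : ∀ n c → ∑ {n} (λ _ → c) ≡ n * c
∑-const zero    c = refl
∑-const (suc n) c = cong (c +_) (∑-const n c)

∑-mono : ∀ {n} (v w : Fin n → ℕ) → (∀ i → v i ≤ w i) → ∑ v ≤ ∑ w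
∑-mono {zero}  v w h = z≤n
∑-mono {suc n} v w h = +-mono-≤ (h zero) (∑-mono (v ∘ suc) (w ∘ suc) (h ∘ suc))

-- The image of `zero` is removed from the range and `punchOut` renumbers the rest.
∑-injective : ∀ {k n} (f : Fin k → Fin n) → Injective _≡_ _≡_ f → (w : Fin n → ℕ) → ∑ (w ∘ f) ≤ ∑ w
∑-injective {zero}            f inj w = z≤n
∑-injective {suc k} {zero}    f inj w with () ← f zero
∑-injective {suc k} {suc n}   f inj w = begin
  w i + ∑ (w ∘ f ∘ suc)          ≡⟨ cong (w i +_) (sum-cong-≗ λ j → sym (removeAt-punchOut w (i≢ j))) ⟩
  w i + ∑ (removeAt w i ∘ g)     ≤⟨ +-monoʳ-≤ (w i) (∑-injective g g-inj (removeAt w i)) ⟩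
  w i + ∑ (removeAt w i)         ≡⟨ sym (sum-remove w) ⟩
  ∑ w                            ∎
  where
  open ≤-Reasoning
  i = f zero
  i≢ : ∀ j → f zero ≢ f (suc j)
  i≢ j eq with () ← inj eq
  g : Fin k → Fin n
  g j = punchOut (i≢ j)
  g-inj : Injective _≡_ _≡_ g
  g-inj {x} {y} eq = Fin.suc-injective (inj (Fin.punchOut-injective (i≢ x) (i≢ y) eq))

∑-opposite : ∀ {n} (w : Fin n → ℕ) → ∑ (w ∘ opposite) ≡ ∑ w
∑-opposite w = ≤-antisym (∑-injective opposite opp-inj w)
  (≤-trans (≤-reflexive (sum-cong-≗ λ i → cong w (sym (Fin.opposite-involutive i))))
           (∑-injective opposite opp-inj (w ∘ opposite)))
  where
  opp-inj : Injective _≡_ _≡_ opposite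
  opp-inj {x} {y} eq = ≡-trans (sym (Fin.opposite-involutive x))
                         (≡-trans (cong opposite eq) (Fin.opposite-involutive y))

choose : ∀ {n} k (χ : Fin n → Bool) → k ≤ ∑ (bit ∘ χ) →
         ∃[ f ] Injective {A = Fin k} {B = Fin n} _≡_ _≡_ f × (∀ j → χ (f j) ≡ true)
choose zero    χ _ = (λ ()) , (λ { {()} }) , λ ()
choose {suc n} (suc k) χ h with χ zero in eq
... | false with f , inj , on ← choose (suc k) (χ ∘ suc) h =
  suc ∘ f , (λ e → inj (Fin.suc-injective e)) , on
... | true  with f , inj , on ← choose k (χ ∘ suc) (s≤s⁻¹ h) = g , g-inj , g-on
  where
  g : Fin (suc k) → Fin (suc n)
  g zero    = zero
  g (suc j) = suc (f j)
  g-inj : Injective _≡_ _≡_ g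
  g-inj {zero}  {zero}  _ = refl
  g-inj {suc x} {suc y} e = cong suc (inj (Fin.suc-injective e))
  g-on : ∀ j → χ (g j) ≡ true
  g-on zero    = eq
  g-on (suc j) = on j

co : ∀ {n} → Graph n → Graph n
co G = record
  { adj     = λ i j → not (adj G i j ∨ eqᵇ i j)
  ; adj-sym = λ i j → cong not (cong₂ _∨_ (adj-sym G i j) (eqᵇ-sym i j))
  ; adj-irr = λ i → cong not (≡-trans (cong (_∨ eqᵇ i i) (adj-irr G i)) (eqᵇ-refl i))
  }

∑-eqᵇ : ∀ {n} (i : Fin n) → ∑ (bit ∘ eqᵇ i) ≡ 1
∑-eqᵇ {suc n} zero    = cong suc (sum-replicate-zero n)
∑-eqᵇ         (suc i) = ≡-trans (sum-cong-≗ λ j → cong bit (eqᵇ-suc j)) (∑-eqᵇ i)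
  where
  eqᵇ-suc : ∀ j → eqᵇ (suc i) (suc j) ≡ eqᵇ i j
  eqᵇ-suc j with i Fin.≟ j
  ... | yes _ = refl
  ... | no  _ = refl

-- For each `j` exactly one of three indicators is 1: non-edge, edge, equality.
deg-co : ∀ {n} (G : Graph n) i → suc (deg (co G) i + deg G i) ≡ n
deg-co {n} G i = begin
  suc (deg (co G) i + deg G i)                      ≡⟨ +-comm 1 _ ⟩
  deg (co G) i + deg G i + 1                        ≡⟨ cong (deg (co G) i + deg G i +_) (sym (∑-eqᵇ i)) ⟩
  deg (co G) i + deg G i + ∑ (bit ∘ eqᵇ i)          ≡⟨ cong (_+ ∑ (bit ∘ eqᵇ i)) (sym (∑-distrib-+ (bit ∘ adj (co G) i) (bit ∘ adj G i))) ⟩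
  ∑ (λ j → bit (adj (co G) i j) + bit (adj G i j)) + ∑ (bit ∘ eqᵇ i)
                                                    ≡⟨ sym (∑-distrib-+ (λ j → bit (adj (co G) i j) + bit (adj G i j)) (bit ∘ eqᵇ i)) ⟩
  ∑ (λ j → bit (adj (co G) i j) + bit (adj G i j) + bit (eqᵇ i j))
                                                    ≡⟨ sum-cong-≗ pointwise ⟩
  ∑ {n} (λ _ → 1)                                   ≡⟨ ∑-const n 1 ⟩
  n * 1                                             ≡⟨ *-identityʳ n ⟩
  n                                                 ∎
  where
  open ≡-Reasoning
  exclusive : ∀ j → adj G i j ≡ true → eqᵇ i j ≡ true → ⊥
  exclusive j p q with i Fin.≟ j
  ... | yes refl with () ← ≡-trans (sym p) (adj-irr G i)
  pointwise : ∀ j → bit (adj (co G) i j) + bit (adj G i j) + bit (eqᵇ i j) ≡ 1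
  pointwise j with adj G i j in p | eqᵇ i j in q
  ... | true  | true  = ⊥-elim (exclusive j p q)
  ... | true  | false = refl
  ... | false | true  = refl
  ... | false | false = refl

-- Translation between degree lists and graphs.

_◃_ : ∀ {n} → (Fin n → Bool) → Graph n → Graph (suc n)
m ◃ G = record { adj = edge ; adj-sym = edge-sym ; adj-irr = edge-irr }
  where
  edge : Fin (suc _) → Fin (suc _) → Bool
  edge zero    zero    = false
  edge zero    (suc j) = m j
  edge (suc i) zero    = m i
  edge (suc i) (suc j) = adj G i j
  edge-sym : ∀ i j → edge i j ≡ edge j i
  edge-sym zero    zero    = refl
  edge-sym zero    (suc j) = refl
  edge-sym (suc i) zero    = refl
  edge-sym (suc i) (suc j) = adj-sym G i j
  edge-irr : ∀ i → edge i i ≡ false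
  edge-irr zero    = refl
  edge-irr (suc i) = adj-irr G i

tail : ∀ {n} → Graph (suc n) → Graph n
tail G = record
  { adj     = λ i j → adj G (suc i) (suc j)
  ; adj-sym = λ i j → adj-sym G (suc i) (suc j)
  ; adj-irr = λ i → adj-irr G (suc i)
  }

lay-bit : ∀ {c L M} b x → Lay c L M → Lay (bit b + c) (bit b + x ∷ L) (x ∷ M)
lay-bit true  x l = take l
lay-bit false x l = skip l

lay-tabulate : ∀ {n} (m : Fin n → Bool) d →
               Lay (∑ (bit ∘ m)) (tabulate λ i → bit (m i) + d i) (tabulate d)
lay-tabulate {zero}  m d = []
lay-tabulate {suc n} m d = lay-bit (m zero) (d zero) (lay-tabulate (m ∘ suc) (d ∘ suc))

gr-of-graph : ∀ {n} (G : Graph n) → Gr (tabulate (deg G))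
gr-of-graph {zero}  G = []
gr-of-graph {suc n} G rewrite adj-irr G zero =
  subst (λ L → Lay (∑ (bit ∘ adj G zero ∘ suc)) L (tabulate (deg (tail G))))
    (tabulate-cong λ i → cong (λ b → bit b + deg (tail G) i) (adj-sym G zero (suc i)))
    (lay-tabulate (adj G zero ∘ suc) (deg (tail G)))
  ∷ᵍ gr-of-graph (tail G)

-- Reads the neighbour set `m` off a layer. The layer skips the prefix `S`, and this is what makes
-- `S` independent in `graph-of-sr`.
lay-mask : ∀ {n c} (r : Fin n → ℕ) S {T T′} → Lay c T T′ → S ++ T ≡ tabulate r →
           ∃[ m ] ∃[ d ] S ++ T′ ≡ tabulate d × (∀ i → r i ≡ bit (m i) + d i)
             × ∑ (bit ∘ m) ≡ c × (∀ (i : Fin n) → toℕ i < length S → m i ≡ false)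
lay-mask {zero}  r [] [] eq = (λ ()) , r , refl , (λ ()) , refl , λ ()
lay-mask {suc n} r (x ∷ S) l eq
  with m , d , e , h , s , off ← lay-mask (r ∘ suc) S l (∷-injectiveʳ eq) =
  false ◂ m , x ◂ d , cong (x ∷_) e ,
  (λ { zero → sym (∷-injectiveˡ eq) ; (suc i) → h i }) , s ,
  λ { zero _ → refl ; (suc i) (s≤s p) → off i p }
lay-mask {suc n} r [] (skip {x = x} l) eq
  with m , d , e , h , s , _ ← lay-mask (r ∘ suc) [] l (∷-injectiveʳ eq) =
  false ◂ m , x ◂ d , cong (x ∷_) e , (λ { zero → sym (∷-injectiveˡ eq) ; (suc i) → h i }) , s , λ _ ()
lay-mask {suc n} r [] (take {x = x} l) eq
  with m , d , e , h , s , _ ← lay-mask (r ∘ suc) [] l (∷-injectiveʳ eq) =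
  true ◂ m , x ◂ d , cong (x ∷_) e , (λ { zero → sym (∷-injectiveˡ eq) ; (suc i) → h i }) , cong suc s , λ _ ()

graph-of-gr : ∀ {n L} (r : Fin n → ℕ) → Gr L → L ≡ tabulate r → ∃[ G ] ∀ i → deg {n} G i ≡ r i
graph-of-gr {zero}  r []       eq = record { adj = λ () ; adj-sym = λ () ; adj-irr = λ () } , λ ()
graph-of-gr {suc n} r (l ∷ᵍ g) eq
  with m , d , e , h , s , _ ← lay-mask (r ∘ suc) [] l (∷-injectiveʳ eq)
  with G , k ← graph-of-gr d g e =
  m ◃ G , λ { zero → ≡-trans s (∷-injectiveˡ eq) ; (suc i) → ≡-trans (cong (bit (m i) +_) (k i)) (sym (h i)) }

graph-of-sr : ∀ {n S T} (r : Fin n → ℕ) → SR S T → S ++ T ≡ tabulate r →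
              ∃[ G ] (∀ i → deg {n} G i ≡ r i)
                × (∀ i j → toℕ i < length S → toℕ j < length S → adj G i j ≡ false)
graph-of-sr r ([] g) eq with G , k ← graph-of-gr r g eq = G , k , λ _ _ ()
graph-of-sr {suc n} {c ∷ S} r (l ∷ sr) eq
  with m , d , e , h , s , off ← lay-mask (r ∘ suc) S l (∷-injectiveʳ eq)
  with G , k , ind ← graph-of-sr d sr e =
  m ◃ G ,
  (λ { zero → ≡-trans s (∷-injectiveˡ eq) ; (suc i) → ≡-trans (cong (bit (m i) +_) (k i)) (sym (h i)) }) ,
  λ { zero    zero    _       _       → refl
    ; zero    (suc j) _       (s≤s q) → off j q
    ; (suc i) zero    (s≤s p) _       → off i p
    ; (suc i) (suc j) (s≤s p) (s≤s q) → ind i j p q }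

tabulate-++ : ∀ s {n} (r : Fin (s + n) → ℕ) →
              tabulate (λ i → r (i ↑ˡ n)) ++ tabulate (λ i → r (s ↑ʳ i)) ≡ tabulate r
tabulate-++ zero    r = refl
tabulate-++ (suc s) r = cong (r zero ∷_) (tabulate-++ s (r ∘ suc))

-- The upper bound.

module _ {n} {π : Seq n} {G : Graph n} (G-π : Realizes G π) where

  deg-realizes : ∀ i → deg G i ≡ π i
  deg-realizes i = ≡-trans (sym (degree≡deg G i)) (G-π i)

  deg-co-+ : ∀ i → suc (deg (co G) i + π i) ≡ n
  deg-co-+ i = subst (λ d → suc (deg (co G) i + d) ≡ n) (deg-realizes i) (deg-co G i)

realizes-co : ∀ {n} {π : Seq n} (H : Graph n) → (∀ i → suc (deg H i + π i) ≡ n) → Realizes (co H) π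
realizes-co {π = π} H h i = ≡-trans (degree≡deg (co H) i)
  (+-cancelʳ-≡ (deg H i) (deg (co H) i) (π i)
    (suc-injective (≡-trans (deg-co H i) (sym (≡-trans (cong suc (+-comm (π i) (deg H i))) (h i))))))

-- The vertices of largest degree are to be independent in the complement. There `s ≤ π i` bounds
-- the degrees by `n`, the length of the other part.
clique : ∀ s n (π : Seq (suc s + n)) → suc s ≤ n → Graphic π → (∀ i → s ≤ π i) →
         PotentiallyGraphic (K (suc s)) π
clique s n π s<n gπ@(mono , G , G-π) s≤π =
  let H , H-r , H-ind = graph-of-sr r (sr-of-gr _ S₀ T₀ ≤-refl σ) (tabulate-++ (suc s) r) in
  gπ , co H , realizes-co H (λ i → subst (λ d → suc (d + π i) ≡ N) (sym (H-r i)) (r+π i)) ,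
  (_↑ˡ n) , (λ {i} {j} → Fin.↑ˡ-injective n i j) , edge H H-ind
  where
  N = suc s + n
  r : Seq N
  r = deg (co G)
  r+π : ∀ i → suc (r i + π i) ≡ N
  r+π = deg-co-+ {π = π} {G} G-π
  r-mono : ∀ i j → toℕ i ≤ toℕ j → r i ≤ r j
  r-mono i j i≤j = +-cancelʳ-≤ (π i) (r i) (r j) (begin
    r i + π i ≡⟨ suc-injective (≡-trans (r+π i) (sym (r+π j))) ⟩
    r j + π j ≤⟨ +-monoʳ-≤ (r j) (mono i j i≤j) ⟩
    r j + π i ∎)
    where open ≤-Reasoning
  r≤n : ∀ i → r i ≤ n
  r≤n i = +-cancelˡ-≤ s _ _ (begin
    s + r i   ≡⟨ +-comm s (r i) ⟩
    r i + s   ≤⟨ +-monoʳ-≤ (r i) (s≤π i) ⟩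
    r i + π i ≡⟨ suc-injective (r+π i) ⟩
    s + n     ∎)
    where open ≤-Reasoning
  S₀ = tabulate (λ i → r (i ↑ˡ n))
  T₀ = tabulate (λ i → r (suc s ↑ʳ i))
  |S| : length S₀ ≡ suc s
  |S| = length-tabulate (λ i → r (i ↑ˡ n))
  |T| : length T₀ ≡ n
  |T| = length-tabulate (λ i → r (suc s ↑ʳ i))
  -- The largest complementary degree within `S₀` will serve as `ρ`.
  last = fromℕ s ↑ˡ n
  σ : Split (r last) S₀ T₀
  σ = split
    (subst₂ _≤_ (sym |S|) (sym |T|) s<n)
    (All.tabulate⁺ λ i → r-mono (i ↑ˡ n) last
      (subst₂ _≤_ (sym (Fin.toℕ-↑ˡ i n)) (sym (Fin.toℕ-↑ˡ (fromℕ s) n)) (Fin.≤fromℕ i)))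
    (All.tabulate⁺ λ i → r-mono last (suc s ↑ʳ i)
      (subst₂ _≤_ (sym (≡-trans (Fin.toℕ-↑ˡ (fromℕ s) n) (Fin.toℕ-fromℕ s)))
                  (sym (Fin.toℕ-↑ʳ (suc s) i)) (m≤n⇒m≤1+n (m≤m+n s (toℕ i)))))
    (All.tabulate⁺ λ i → subst (r (suc s ↑ʳ i) ≤_) (sym |T|) (r≤n (suc s ↑ʳ i)))
    (subst Gr (sym (tabulate-++ (suc s) r)) (gr-of-graph (co G)))
  below : ∀ i → toℕ (i ↑ˡ n) < length S₀
  below i = subst₂ _<_ (sym (Fin.toℕ-↑ˡ i n)) (sym |S|) (Fin.toℕ<n i)
  edge : (H : Graph N) → (∀ i j → toℕ i < length S₀ → toℕ j < length S₀ → adj H i j ≡ false) →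
         ∀ i j → adj (K (suc s)) i j ≡ true → adj (co H) (i ↑ˡ n) (j ↑ˡ n) ≡ true
  edge H ind i j h
    rewrite ind (i ↑ˡ n) (j ↑ˡ n) (below i) (below j) with (i ↑ˡ n) Fin.≟ (j ↑ˡ n) | i Fin.≟ j
  ... | no _  | _      = refl
  ... | yes e | no i≢j = contradiction (Fin.↑ˡ-injective n i j e) i≢j
  ... | yes e | yes _  with () ← h

graphic-complement : ∀ {n} {π : Seq n} → Graphic π → Graphic (complementSeq π)
graphic-complement {n} {π} (mono , G , G-π) =
  (λ i j i≤j → ∸-monoʳ-≤ (n ∸ 1) (mono (opposite j) (opposite i) (opposite-mono i j i≤j))) , G̅ , real
  where
  opposite-mono : ∀ (i j : Fin n) → toℕ i ≤ toℕ j → toℕ (opposite j) ≤ toℕ (opposite i)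
  opposite-mono i j i≤j = subst₂ _≤_ (sym (Fin.opposite-prop j)) (sym (Fin.opposite-prop i))
                            (∸-monoʳ-≤ n (s≤s i≤j))
  G̅ : Graph n
  G̅ = record
    { adj     = λ i j → adj (co G) (opposite i) (opposite j)
    ; adj-sym = λ i j → adj-sym (co G) (opposite i) (opposite j)
    ; adj-irr = λ i → adj-irr (co G) (opposite i)
    }
  real : Realizes G̅ (complementSeq π)
  real i = begin
    degree G̅ i                         ≡⟨ degree≡deg G̅ i ⟩
    deg G̅ i                            ≡⟨ ∑-opposite (bit ∘ adj (co G) (opposite i)) ⟩
    deg (co G) (opposite i)            ≡⟨ sym (m+n∸n≡m _ (π (opposite i))) ⟩
    deg (co G) (opposite i) + π (opposite i) ∸ π (opposite i)
                                       ≡⟨ cong (λ m → m ∸ 1 ∸ π (opposite i)) (deg-co-+ {π = π} {G} G-π (opposite i)) ⟩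
    n ∸ 1 ∸ π (opposite i)             ∎
    where open ≡-Reasoning

star : ∀ {n} t {π : Seq n} → Graphic π → ∀ i → t ≤ π i → PotentiallyGraphic (Star (suc t)) π
star {n} t {π} gπ@(_ , G , G-π) i t≤
  with f , f-inj , on ← choose t (adj G i)
         (subst (t ≤_) (sym (deg-realizes {π = π} {G} G-π i)) t≤) =
  gπ , G , G-π , g , g-inj , edge
  where
  g : Fin (suc t) → Fin n
  g zero    = i
  g (suc j) = f j
  i≢f : ∀ j → i ≢ f j
  i≢f j eq with () ← ≡-trans (sym (adj-irr G i)) (≡-trans (cong (adj G i) eq) (on j))
  g-inj : Injective _≡_ _≡_ g
  g-inj {zero}  {zero}  _  = refl
  g-inj {zero}  {suc y} eq = contradiction eq (i≢f y)
  g-inj {suc x} {zero}  eq = contradiction (sym eq) (i≢f x)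
  g-inj {suc x} {suc y} eq = cong suc (f-inj eq)
  edge : ∀ x y → starAdj x y ≡ true → adj G (g x) (g y) ≡ true
  edge zero    (suc y) _ = on y
  edge (suc x) zero    _ = ≡-trans (adj-sym G (f x) i) (on x)

ramsey : ∀ s t n → suc s ≤ n → t ≤ suc n → RamseyProp (K (suc s)) (Star (suc t)) (suc s + n)
ramsey s t n s<n t≤ π gπ with Fin.any? (λ i → t ≤? complementSeq π i)
... | yes (i , h) = inj₂ (star t {complementSeq π} (graphic-complement {π = π} gπ) i h)
-- Complementary degrees are below `t ≤ suc n`, hence at most `n`, which forces `s ≤ π i`.
... | no none     = inj₁ (clique s n π s<n gπ λ i → +-cancelʳ-≤ n s (π i) (begin
  s + n                                  ≤⟨ m≤n+m∸n (s + n) (π i) ⟩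
  π i + (s + n ∸ π i)                    ≤⟨ +-monoʳ-≤ (π i) (s≤s⁻¹ (≤-trans (≰⇒> (small i)) t≤)) ⟩
  π i + n                                ∎))
  where
  open ≤-Reasoning
  small : ∀ i → ¬ t ≤ s + n ∸ π i
  small i h = none (opposite i , subst (λ j → t ≤ s + n ∸ π j) (sym (Fin.opposite-involutive i)) h)

-- The lower bound.

step : ∀ {n} → ℕ → ℕ → ℕ → Seq n
step a x y i = if toℕ i <ᵇ a then x else y

tabulate-step : ∀ a b {x y} → tabulate {n = a + b} (step a x y) ≡ replicate a x ++ replicate b y
tabulate-step zero    zero    = refl
tabulate-step zero    (suc b) {x} = cong (_ ∷_) (tabulate-step 0 b {x})
tabulate-step (suc a) b       = cong (_ ∷_) (tabulate-step a b)

step-≥ : ∀ {n} a {x y} (i : Fin n) → y ≤ x → y ≤ step a x y i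
step-≥ a i y≤x with toℕ i <ᵇ a
... | true  = y≤x
... | false = ≤-refl

step-above : ∀ {n} a {x y} (i : Fin n) → y < step a x y i → toℕ i < a
step-above a i y< with toℕ i <ᵇ a in eq
... | true  = <ᵇ⇒< (toℕ i) a (subst True (sym eq) tt)
... | false = contradiction y< (<-irrefl refl)

step-mono : ∀ {n} a {x y} → y ≤ x → Nonincreasing {n} (step a x y)
step-mono a y≤x i j i≤j with toℕ j <ᵇ a in eq | toℕ i <ᵇ a in eq′
... | true  | true  = ≤-refl
... | false | true  = y≤x
... | false | false = ≤-refl
... | true  | false = contradiction (≤-<-trans i≤j (<ᵇ⇒< (toℕ j) a (subst True (sym eq) tt)))
                        λ i<a → subst True eq′ (<⇒<ᵇ i<a)

gr-zeros : ∀ n → Gr (replicate n 0)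
gr-zeros zero    = []
gr-zeros (suc n) = lay-none _ ∷ᵍ gr-zeros n

-- The join of a complete graph on `a` vertices with `suc b` independent ones: a vertex of the
-- complete side is adjacent to all others.
gr-join : ∀ a b → Gr (replicate a (a + b) ++ replicate (suc b) a)
gr-join zero    b = gr-zeros (suc b)
gr-join (suc a) b =
  subst (λ c → Lay c (replicate a (suc a + b) ++ replicate (suc b) (suc a)) (replicate a (a + b) ++ replicate (suc b) a)) (+-suc a b)
    (lay-++ (lay-replicate a (a + b)) (lay-replicate (suc b) a))
  ∷ᵍ gr-join a b

graphic-of-gr : ∀ {n} {π : Seq n} → Nonincreasing π → Gr (tabulate π) → Graphic π
graphic-of-gr {π = π} mono g with G , h ← graph-of-gr π g refl =
  mono , G , λ i → ≡-trans (degree≡deg G i) (h i)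

subgraph-deg : ∀ {k n} {H : Graph k} {G : Graph n} ((f , _) : SubgraphOf H G) → ∀ i → deg H i ≤ deg G (f i)
subgraph-deg {H = H} {G} (f , inj , edge) i =
  ≤-trans (∑-mono _ _ pointwise) (∑-injective f inj (bit ∘ adj G (f i)))
  where
  pointwise : ∀ j → bit (adj H i j) ≤ bit (adj G (f i) (f j))
  pointwise j with adj H i j in eq
  ... | true  rewrite edge i j eq = ≤-refl
  ... | false = z≤n

-- `K s` is by computation the complement of the empty graph.
deg-K : ∀ s i → suc (deg (K s) i) ≡ s
deg-K s i = ≡-trans (cong suc (sym (+-identityʳ _)))
  (≡-trans (cong (λ d → suc (deg (K s) i + d)) (sym (sum-replicate-zero s))) (deg-co ∅ i))
  where
  ∅ : Graph s
  ∅ = record { adj = λ _ _ → false ; adj-sym = λ _ _ → refl ; adj-irr = λ _ → refl }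

no-star : ∀ {n} t {π : Seq n} → (∀ i → n ∸ 1 ∸ π i < t) → ¬ PotentiallyGraphic (Star (suc t)) (complementSeq π)
no-star t {π} small (_ , G , G-π , sub@(f , _)) = <-irrefl refl (begin-strict
  t                         ≡⟨ sym (≡-trans (∑-const t 1) (*-identityʳ t)) ⟩
  deg (Star (suc t)) zero   ≤⟨ subgraph-deg {H = Star (suc t)} {G} sub zero ⟩
  deg G (f zero)            ≡⟨ deg-realizes {π = complementSeq π} {G} G-π (f zero) ⟩
  complementSeq π (f zero)  <⟨ small (opposite (f zero)) ⟩
  t                         ∎)
  where open ≤-Reasoning

clique-degree : ∀ {s n} {π : Seq n} (G : Graph n) → Realizes G π → ((f , _) : SubgraphOf (K s) G) → ∀ i → s ≤ suc (π (f i))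
clique-degree {s} {π = π} G G-π sub@(f , _) i = begin
  s                   ≡⟨ sym (deg-K s i) ⟩
  suc (deg (K s) i)   ≤⟨ s≤s (subgraph-deg {H = K s} {G} sub i) ⟩
  suc (deg G (f i))   ≡⟨ cong suc (deg-realizes {π = π} {G} G-π (f i)) ⟩
  suc (π (f i))       ∎
  where open ≤-Reasoning

-- A clique vertex needs degree at least s - 1 > a, which only the a vertices of the
-- complete side have.
¬ramsey-join : ∀ {s t} a b → suc a < s → b < t → ¬ RamseyProp (K s) (Star (suc t)) (a + suc b)
¬ramsey-join {s} {t} a b a<s b<t R
  with R (step a (a + b) a) (graphic-of-gr (step-mono a (m≤m+n a b))
         (subst Gr (sym (tabulate-step a (suc b))) (gr-join a b)))
... | inj₂ P = no-star t {step a (a + b) a} (λ i → begin-strict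
  a + suc b ∸ 1 ∸ step a (a + b) a i ≤⟨ ∸-monoʳ-≤ (a + suc b ∸ 1) (step-≥ a i (m≤m+n a b)) ⟩
  a + suc b ∸ 1 ∸ a                  ≡⟨ cong (λ m → m ∸ 1 ∸ a) (+-suc a b) ⟩
  a + b ∸ a                          ≡⟨ m+n∸m≡n a b ⟩
  b                                  <⟨ b<t ⟩
  t                                  ∎) P
  where open ≤-Reasoning
... | inj₁ (_ , G , G-π , sub@(f , inj , _)) =
  let i , j , i<j , eq = Fin.pigeonhole (<-trans (n<1+n a) a<s) (λ i → fromℕ< (below i)) in
  Fin.<⇒≢ i<j (inj (Fin.toℕ-injective (Fin.fromℕ<-injective (toℕ (f i)) (toℕ (f j)) (below i) (below j) eq)))
  where
  below : ∀ i → toℕ (f i) < a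
  below i = step-above a (f i) (s≤s⁻¹ (≤-trans a<s (clique-degree {π = step a (a + b) a} G G-π sub i)))

¬ramsey-empty : ∀ {s t} → ¬ RamseyProp (K (suc s)) (Star (suc t)) 0
¬ramsey-empty R with R (λ ()) (graphic-of-gr (λ ()) [])
... | inj₁ (_ , _ , _ , f , _) with () ← f zero
... | inj₂ (_ , _ , _ , f , _) with () ← f zero

¬ramsey-small : ∀ {s t M} → M < t + suc (suc s) → ¬ RamseyProp (K (suc (suc s))) (Star (suc (suc t))) M
¬ramsey-small {M = zero} _ = ¬ramsey-empty
¬ramsey-small {s} {t} {suc m} M< R with ≤-total m s
-- With `b = 0` the join is the complete graph on `suc m` vertices, too few for the clique.
... | inj₁ m≤s = ¬ramsey-join m 0 (s≤s (s≤s m≤s)) (s≤s z≤n)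
                   (subst (RamseyProp (K (suc (suc s))) (Star (suc (suc t)))) (+-comm 1 m) R)
... | inj₂ s≤m with b , refl ← m≤n⇒∃[o]m+o≡n s≤m =
  ¬ramsey-join s b ≤-refl (s≤s (+-cancelˡ-≤ s b t (s≤s⁻¹ (s≤s⁻¹ (≤-trans M< (≤-reflexive (lemma s t)))))))
    (subst (RamseyProp (K (suc (suc s))) (Star (suc (suc t)))) (sym (+-suc s b)) R)
  where
  lemma : ∀ s t → t + suc (suc s) ≡ suc (suc (s + t))
  lemma = solve-∀

-- Each of the s clique vertices sends c red edges outside the clique, and every outside
-- vertex receives at most c of them.
clique-size : ∀ {s n} {G : Graph n} c → (∀ i → deg (co G) i ≡ c) → 0 < c → SubgraphOf (K s) G → s + s ≤ n
clique-size {s} {n} {G} c@(suc _) H-c _ (f , inj , edge) = *-cancelʳ-≤ (s + s) n c (begin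
  (s + s) * c                   ≡⟨ *-distribʳ-+ c s s ⟩
  s * c + s * c                 ≡⟨ cong₂ _+_ (sym inside) (sym total) ⟩
  ∑ (free ∘ f) + ∑ red          ≤⟨ +-monoˡ-≤ (∑ red) (∑-injective f inj free) ⟩
  ∑ free + ∑ red                ≡⟨ sym (∑-distrib-+ free red) ⟩
  ∑ (λ j → free j + red j)      ≡⟨ sum-cong-≗ (λ j → m∸n+n≡m (red≤ j)) ⟩
  ∑ {n} (λ _ → c)               ≡⟨ ∑-const n c ⟩
  n * c                         ∎)
  where
  open ≤-Reasoning
  -- Red edges are those of `co G`; `red j` counts those from the clique to `j`, and `free j` is the
  -- rest of `c`, all of it at clique vertices.
  red free : Fin n → ℕ
  red j = ∑ (λ a → bit (adj (co G) (f a) j))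
  free j = c ∸ red j
  red≤ : ∀ j → red j ≤ c
  red≤ j = ≤-trans (∑-injective f inj (λ i → bit (adj (co G) i j)))
    (≤-reflexive (≡-trans (sum-cong-≗ λ i → cong bit (adj-sym (co G) i j)) (H-c j)))
  total : ∑ red ≡ s * c
  total = ≡-trans (sym (∑-comm λ a j → bit (adj (co G) (f a) j)))
    (≡-trans (sum-cong-≗ (H-c ∘ f)) (∑-const s c))
  non-red : ∀ a b → bit (adj (co G) (f a) (f b)) ≡ 0
  non-red a b with a Fin.≟ b in eq
  ... | yes refl = cong bit (adj-irr (co G) (f a))
  ... | no  _    = cong (λ x → bit (not (x ∨ eqᵇ (f a) (f b)))) (edge a b (cong (not ∘ ⌊_⌋) eq))
  inside : ∑ (free ∘ f) ≡ s * c
  inside = ≡-trans (sum-cong-≗ λ b → cong (c ∸_) (≡-trans (sum-cong-≗ λ a → non-red a b) (sum-replicate-zero s)))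
                   (∑-const s c)

-- The constant sequence `M ∸ 3` has 2-regular complements only: no vertex there has `t` neighbours,
-- and `clique-size` with `c = 2` excludes the clique.
¬ramsey-cycle : ∀ {s t M} → 2 < M → M < s + s → 2 < t → ¬ RamseyProp (K s) (Star (suc t)) M
¬ramsey-cycle {M = 1} (s≤s ())
¬ramsey-cycle {M = 2} (s≤s (s≤s ()))
¬ramsey-cycle {s} {t} {suc (suc (suc m))} M> M< t> R
  with H , h ← graph-of-gr {n = 3 + m} (λ _ → 2)
         (gr-flat _ 0 (3 + m) 2 ≤-refl (λ ()) (λ _ → M>) (subst (2 ∣_) (sym (sum-replicate (3 + m) 2)) (n∣m*n (3 + m))))
         (sym (tabulate-step 0 (3 + m) {2}))
  with R (λ _ → m) ((λ _ _ _ → ≤-refl) , co H , realizes-co H (λ i → cong (λ d → suc (d + m)) (h i)))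
... | inj₁ (_ , G , G-π , sub) = <⇒≱ M< (clique-size {G = G} 2
        (λ i → +-cancelʳ-≡ m _ 2 (suc-injective (deg-co-+ {π = λ _ → m} {G} G-π i))) (s≤s z≤n) sub)
... | inj₂ P = no-star t {λ _ → m} (λ i → subst (_< t) (sym (m+n∸n≡m 2 m)) t>) P

-- The two cases of the formula.

theorem5 : ∀ (s t : ℕ) → 4 ≤ s → 4 ≤ t → IsPotRamsey (K s) (Star t) (rpotValue s t)
theorem5 s@(suc (suc s₂)) t@(suc (suc t₂)) 4≤s@(s≤s (s≤s _)) 4≤t@(s≤s (s≤s _)) with t <ᵇ s + 2 in eq
... | true  =
  subst (RamseyProp (K s) (Star t)) (cong (s +_) (sym (+-identityʳ s)))
    (ramsey (suc s₂) (suc t₂) s ≤-refl (m≤n⇒m≤1+n t≤)) ,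
  λ M M< → lower M (subst (λ n → M < s + n) (+-identityʳ s) M<)
  where
  t≤ : suc t₂ ≤ s
  t≤ = s≤s⁻¹ (s≤s⁻¹ (subst (t <_) (+-comm s 2) (<ᵇ⇒< t (s + 2) (subst True (sym eq) tt))))
  lower : ∀ M → M < s + s → ¬ RamseyProp (K s) (Star t) M
  lower M M< with <-≤-connex M (t₂ + s)
  -- Below `t + s - 2` the join suffices; from there on `M ≥ s ≥ 4` leaves room for a 2-regular
  -- complement.
  ... | inj₁ small = ¬ramsey-small small
  ... | inj₂ large = ¬ramsey-cycle (≤-trans (<⇒≤ 4≤s) (≤-trans (m≤n+m s t₂) large)) M< (s≤s⁻¹ 4≤t)
-- Now `t ≥ s + 2`, so the `t₂` vertices outside the clique are at least `s` in number.
... | false =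
  subst (RamseyProp (K s) (Star t)) (+-comm s t₂) (ramsey (suc s₂) (suc t₂) t₂ s≤ ≤-refl) ,
  λ M M< → ¬ramsey-small M<
  where
  s≤ : s ≤ t₂
  s≤ = s≤s⁻¹ (s≤s⁻¹ (subst (_≤ t) (+-comm s 2) (≮⇒≥ λ t< → subst True eq (<⇒<ᵇ t<))))
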